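{- Let $(I,+,\preceq_I,\ast)$ be a partially ordered commutative ring. Let $x_1,\dots,x_7\in I$ with $x_i\succeq_I x_{i+1}$ for $1\leq i\leq 6$ and $x_1+x_6\succeq_I x_2+x_5\succeq_I x_3+x_4$, and let $n\geq 0$ be an integer. Suppose that the multiplicative inverse $(x_2-x_6)^{ -1}$ exists in $I$ and $(x_2-x_6)^{ -1}\succ_I 0$. Let $a_1,\dots,a_7\in I$ and suppose that for each $i\in\{2,4,6\}$ there is an upper bound $\hat a_i\in I$ of $\{a_i,-a_i\}$ such that $a_1\succeq_I\hat a_2\succeq_I a_5\succeq_I\hat a_6\succeq_I 0$, $a_3\succeq_I\hat a_4\succeq_I 0$, and either $a_5+a_7\succeq_I\hat a_6\succeq_I a_7\succeq_I 0$ or $a_7\succeq_I\hat a_6\succeq_I 0$. Then $$\sum_{i=1}^7 a_i\ast\prod_{\substack{1\leq j\leq 7\\ j\neq i}}(x_i-x_j)^n\succeq_I 0,$$ where the product is taken with respect to $\ast$.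
   Context: A partially ordered Abelian group $(I,+,\preceq_I)$ is an Abelian group with a partial order such that $x+z\preceq_I y+z\Leftrightarrow x\preceq_I y$ for all $x,y,z\in I$. A partially ordered commutative ring $(I,+,\preceq_I,\ast)$ is a partially ordered Abelian group together with an operation $\ast:I\times I\to I$ that is associative, commutative, distributive over $+$, nonnegativity-preserving ($x\succeq_I 0$ and $y\succeq_I 0$ imply $x\ast y\succeq_I 0$), and has an identity element in $I$. Powers $x^n$ and inverses are with respect to $\ast$. An element $u$ is an upper bound of $S\subset I$ if $u\succeq_I s$ for all $s\in S$. -}

module Defs where

open import Algebra.Bundles using (AbelianGroup; CommutativeRing; Semiring)
import Algebra.Definitions.RawSemiring as RawSemiringDefinitions
open import Data.Fin.Base using (zero; suc)
open import Data.Product.Base using (_×_)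
open import Data.Sum.Base using (_⊎_)
open import Function.Bundles using (_⇔_)
open import Level using (Level; _⊔_) renaming (suc to lsuc)
open import Relation.Binary.Core using (Rel)
open import Relation.Binary.Structures using (IsPartialOrder)
open import Relation.Unary using (Pred; _∈_)

record IsPartiallyOrderedAbelianGroup {c ℓ₁ ℓ₂ : Level} (G : AbelianGroup c ℓ₁)
         (_⪯_ : Rel (AbelianGroup.Carrier G) ℓ₂) : Set (c ⊔ ℓ₁ ⊔ ℓ₂) where
  open AbelianGroup G
  field
    isPartialOrder : IsPartialOrder _≈_ _⪯_
    translation    : ∀ x y z → ((x ∙ z) ⪯ (y ∙ z)) ⇔ (x ⪯ y)

record PartiallyOrderedCommutativeRing (c ℓ₁ ℓ₂ : Level) : Set (lsuc (c ⊔ ℓ₁ ⊔ ℓ₂)) where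
  field
    commutativeRing : CommutativeRing c ℓ₁

  open CommutativeRing commutativeRing public

  infix 4 _⪯_ _⪰_ _≻_
  field
    _⪯_ : Rel Carrier ℓ₂
    isPartiallyOrderedAbelianGroup : IsPartiallyOrderedAbelianGroup +-abelianGroup _⪯_

  _⪰_ : Rel Carrier ℓ₂
  x ⪰ y = y ⪯ x

  _≻_ : Rel Carrier (ℓ₁ ⊔ ℓ₂)
  x ≻ y = x ⪰ y × x ≉ y

  field
    *-nonneg : ∀ x y → x ⪰ 0# → y ⪰ 0# → x * y ⪰ 0#

  open IsPartiallyOrderedAbelianGroup isPartiallyOrderedAbelianGroup public

  open RawSemiringDefinitions
    (Semiring.rawSemiring semiring) public
    using (sum; product; _^_)

  UpperBound : {ℓ : Level} → Pred Carrier ℓ → Carrier → Set (c ⊔ ℓ₂ ⊔ ℓ)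
  UpperBound S u = ∀ s → s ∈ S → u ⪰ s

  -- The set {a, - a}, up to _≈_.
  ⟦±_⟧ : Carrier → Pred Carrier ℓ₁
  ⟦± a ⟧ s = s ≈ a ⊎ s ≈ - a

-- Fin 7 starts at zero; the entries x₁, …, x₇ are numbered from one.
pattern ₁ = zero
pattern ₂ = suc ₁
pattern ₃ = suc ₂
pattern ₄ = suc ₃
pattern ₅ = suc ₄
pattern ₆ = suc ₅
pattern ₇ = suc ₆

{-# OPTIONS --safe #-}

-- Put Qᵢ = ∏_{j≠i} |xᵢ - xⱼ|.  The i-th product is Qᵢⁿ for odd i and ± Qᵢⁿ for even i, so it
-- suffices to show a₁Q₁ⁿ - â₂Q₂ⁿ + a₃Q₃ⁿ - â₄Q₄ⁿ + a₅Q₅ⁿ - â₆Q₆ⁿ + a₇Q₇ⁿ ⪰ 0.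
-- This is a combination with nonnegative coefficients of the Qᵢⁿ and of Q₁ⁿ - Q₂ⁿ, Q₃ⁿ - Q₄ⁿ,
-- Q₇ⁿ - Q₆ⁿ and Q₁ⁿ + Q₅ⁿ - Q₂ⁿ - Q₆ⁿ.  Nonnegativity of the last difference is strengthened to
-- a relation on quadruples that is stable under multiplication (see Majorizes), which reduces it
-- to n = 1 and, there, to products of few factors xᵢ - xⱼ.  The inverse of x₂ - x₆ gives 1 ⪰ 0,
-- hence nonnegative powers for n = 0.
module Submission where

open import Defs
open import Algebra.Bundles using (CommutativeMonoid; CommutativeRing; RawRing)
open import Algebra.Definitions using (Invertible)
import Algebra.Properties.CommutativeSemigroup as CommutativeSemigroupProperties
import Algebra.Properties.Ring as RingProperties
import Algebra.Properties.Semiring.Mult as SemiringMult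
import Algebra.Properties.Semiring.Exp as SemiringExp
import Algebra.Properties.CommutativeSemiring.Exp as CommutativeSemiringExp
import Algebra.Solver.Ring as RingSolver
open import Algebra.Solver.Ring.AlmostCommutativeRing
  using (_-Raw-AlmostCommutative⟶_; fromCommutativeRing; Induced-equivalence)
open import Data.Fin.Base using (Fin; zero; suc; inject₁; _≤_)
open import Data.Fin.Properties using (_≤?_)
open import Data.Maybe.Base using (map)
open import Data.Nat.Base as ℕ using (ℕ; zero; suc; z≤n; s≤s⁻¹)
import Data.Nat.Properties as ℕ
open import Data.Product.Base using (_×_; _,_; proj₁)
open import Data.Sum.Base as Sum using (_⊎_; inj₁; inj₂)
open import Data.Vec.Functional using (Vector; removeAt; tail)
open import Level using (Level)
open import Relation.Binary.Consequences using (dec⇒weaklyDec)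
open import Relation.Binary.Definitions using (WeaklyDecidable)
open import Relation.Binary.PropositionalEquality.Core as ≡ using (_≡_)
open import Relation.Binary.Structures using (IsPartialOrder)
import Relation.Binary.Reasoning.Setoid as SetoidReasoning
open import Relation.Nullary.Decidable using (True; toWitness)
open import Function.Bundles using (Equivalence)

-- A ring solver for an arbitrary commutative ring that recognises cancellation.  A coefficient
-- (m , n) stands for the integer m - n; representatives need not be unique.
module IntegerCoefficientSolver {c ℓ} (R : CommutativeRing c ℓ) where
  open CommutativeRing R
  open SemiringMult semiring using (×-homo-+; ×1-homo-*) renaming (_×_ to _·_)
  open RingProperties ring
    using (-0#≈0#; -‿+-comm; ⁻¹-anti-homo-//; x[y-z]≈xy-xz; [y-z]x≈yx-zx)
  open CommutativeSemigroupProperties (CommutativeMonoid.commutativeSemigroup +-commutativeMonoid)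
    using (interchange)
  open SetoidReasoning setoid

  private
    almostRing = fromCommutativeRing R

    differences : RawRing _ _
    differences = record
      { Carrier = ℕ × ℕ
      ; _≈_     = _≡_
      ; _+_     = λ (m , n) (p , q) → m ℕ.+ p , n ℕ.+ q
      ; _*_     = λ (m , n) (p , q) → m ℕ.* p ℕ.+ n ℕ.* q , m ℕ.* q ℕ.+ n ℕ.* p
      ; -_      = λ (m , n) → n , m
      ; 0#      = 0 , 0
      ; 1#      = 1 , 0
      }

    ⟦_⟧ : ℕ × ℕ → Carrier
    ⟦ m , n ⟧ = m · 1# - n · 1#

    +-swap : ∀ a b c d → (a + b) - (c + d) ≈ (a - c) + (b - d)
    +-swap a b c d = trans (+-congˡ (sym (-‿+-comm c d))) (interchange a b (- c) (- d))

    *-expand : ∀ a b c d → (a * c + b * d) - (a * d + b * c) ≈ (a - b) * (c - d)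
    *-expand a b c d = begin
      (a * c + b * d) - (a * d + b * c)  ≈⟨ +-swap _ _ _ _ ⟩
      (a * c - a * d) + (b * d - b * c)  ≈⟨ +-congˡ (⁻¹-anti-homo-// (b * c) (b * d)) ⟨
      (a * c - a * d) - (b * c - b * d)  ≈⟨ +-cong (x[y-z]≈xy-xz a c d)
                                                   (-‿cong (x[y-z]≈xy-xz b c d)) ⟨
      a * (c - d) - b * (c - d)          ≈⟨ [y-z]x≈yx-zx (c - d) a b ⟨
      (a - b) * (c - d)                  ∎

    shift : ∀ a b d → a - b ≈ (a + d) - (b + d)
    shift a b d = begin
      a - b              ≈⟨ +-identityʳ _ ⟨
      (a - b) + 0#       ≈⟨ +-congˡ (-‿inverseʳ d) ⟨
      (a - b) + (d - d)  ≈⟨ +-swap a d b d ⟨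
      (a + d) - (b + d)  ∎

    homomorphism : differences -Raw-AlmostCommutative⟶ almostRing
    homomorphism = record
      { ⟦_⟧    = ⟦_⟧
      ; +-homo = λ (m , n) (p , q) → trans
          (+-cong (×-homo-+ 1# m p) (-‿cong (×-homo-+ 1# n q)))
          (+-swap (m · 1#) (p · 1#) (n · 1#) (q · 1#))
      ; *-homo = λ (m , n) (p , q) → trans
          (+-cong (·-products m p n q) (-‿cong (·-products m q n p)))
          (*-expand (m · 1#) (n · 1#) (p · 1#) (q · 1#))
      ; -‿homo = λ (m , n) → sym (⁻¹-anti-homo-// (m · 1#) (n · 1#))
      ; 0-homo = -‿inverseʳ 0#
      ; 1-homo = trans (+-cong (+-identityʳ 1#) -0#≈0#) (+-identityʳ 1#)
      }
      where
      ·-products : ∀ m p n q →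
        (m ℕ.* p ℕ.+ n ℕ.* q) · 1# ≈ (m · 1#) * (p · 1#) + (n · 1#) * (q · 1#)
      ·-products m p n q = trans (×-homo-+ 1# (m ℕ.* p) (n ℕ.* q))
                                 (+-cong (×1-homo-* m p) (×1-homo-* n q))

    _≟_ : WeaklyDecidable (Induced-equivalence homomorphism)
    -- Equal cross sums give equal values in every commutative ring. Weak decidability asks for no
    -- converse, which fails in positive characteristic.
    (m , n) ≟ (p , q) = map sound (dec⇒weaklyDec ℕ._≟_ (m ℕ.+ q) (p ℕ.+ n))
      where
      sound : m ℕ.+ q ≡ p ℕ.+ n → ⟦ m , n ⟧ ≈ ⟦ p , q ⟧
      sound eq = begin
        m · 1# - n · 1#                        ≈⟨ shift (m · 1#) (n · 1#) (q · 1#) ⟩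
        (m · 1# + q · 1#) - (n · 1# + q · 1#)  ≈⟨ +-cong sum≈ (-‿cong (+-comm _ _)) ⟩
        (p · 1# + n · 1#) - (q · 1# + n · 1#)  ≈⟨ shift (p · 1#) (q · 1#) (n · 1#) ⟨
        p · 1# - q · 1#                        ∎
        where
        sum≈ : m · 1# + q · 1# ≈ p · 1# + n · 1#
        sum≈ = begin
          m · 1# + q · 1#  ≈⟨ ×-homo-+ 1# m q ⟨
          (m ℕ.+ q) · 1#   ≡⟨ ≡.cong (_· 1#) eq ⟩
          (p ℕ.+ n) · 1#   ≈⟨ ×-homo-+ 1# p n ⟩
          p · 1# + n · 1#  ∎

  open RingSolver differences almostRing homomorphism _≟_ public
    using (solve; _:+_; _:*_; _:-_; :-_; _:=_)

-- Inequalities in a partially ordered commutative ring.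

module OrderedRing {c ℓ₁ ℓ₂ : Level} (I : PartiallyOrderedCommutativeRing c ℓ₁ ℓ₂) where
  open PartiallyOrderedCommutativeRing I hiding (zero)
  open IntegerCoefficientSolver commutativeRing
  open RingProperties ring using (⁻¹-anti-homo‿-)
  open SemiringExp semiring using (^-congˡ)
  open CommutativeSemiringExp commutativeSemiring using (^-distrib-*)
  open IsPartialOrder isPartialOrder using (≤-respˡ-≈; ≤-respʳ-≈)
    renaming (refl to ⪯-refl; trans to ⪯-trans)

  0⪯-resp-≈ : ∀ {x y} → x ≈ y → 0# ⪯ y → 0# ⪯ x
  0⪯-resp-≈ x≈y = ≤-respʳ-≈ (sym x≈y)

  private
    [y-x]+x≈y : ∀ x y → (y - x) + x ≈ y
    [y-x]+x≈y = solve 2 (λ x y → (y :- x) :+ x := y) refl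

  ⪯⇒0⪯- : ∀ {x y} → x ⪯ y → 0# ⪯ y - x
  ⪯⇒0⪯- {x} {y} x⪯y = Equivalence.to (translation 0# (y - x) x)
    (≤-respˡ-≈ (sym (+-identityˡ x)) (≤-respʳ-≈ (sym ([y-x]+x≈y x y)) x⪯y))

  0⪯-⇒⪯ : ∀ {x y} → 0# ⪯ y - x → x ⪯ y
  0⪯-⇒⪯ {x} {y} 0⪯y-x = ≤-respˡ-≈ (+-identityˡ x) (≤-respʳ-≈ ([y-x]+x≈y x y)
    (Equivalence.from (translation 0# (y - x) x) 0⪯y-x))

  0⪯≈-⇒⪯ : ∀ {x y z} → y - x ≈ z → 0# ⪯ z → x ⪯ y
  0⪯≈-⇒⪯ eq 0⪯z = 0⪯-⇒⪯ (0⪯-resp-≈ eq 0⪯z)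

  +-mono-⪯ : ∀ {x y z w} → x ⪯ y → z ⪯ w → x + z ⪯ y + w
  +-mono-⪯ {x} {y} {z} {w} x⪯y z⪯w = ⪯-trans
    (Equivalence.from (translation x y z) x⪯y)
    (≤-respˡ-≈ (+-comm z y) (≤-respʳ-≈ (+-comm w y) (Equivalence.from (translation z w y) z⪯w)))

  0⪯+ : ∀ {x y} → 0# ⪯ x → 0# ⪯ y → 0# ⪯ x + y
  0⪯+ 0⪯x 0⪯y = ≤-respˡ-≈ (+-identityˡ 0#) (+-mono-⪯ 0⪯x 0⪯y)

  0⪯* : ∀ {x y} → 0# ⪯ x → 0# ⪯ y → 0# ⪯ x * y
  0⪯* {x} {y} = *-nonneg x y

  *-mono-⪯ : ∀ {x y z w} → 0# ⪯ x → x ⪯ y → 0# ⪯ z → z ⪯ w → x * z ⪯ y * w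
  *-mono-⪯ {x} {y} {z} {w} 0⪯x x⪯y 0⪯z z⪯w = 0⪯≈-⇒⪯
    (solve 4 (λ x y z w → y :* w :- x :* z := y :* (w :- z) :+ (y :- x) :* z) refl x y z w)
    (0⪯+ (0⪯* (⪯-trans 0⪯x x⪯y) (⪯⇒0⪯- z⪯w)) (0⪯* (⪯⇒0⪯- x⪯y) 0⪯z))

  -- Over the reals, the concave quadratic in `u` given by `(p - u) * (u - q)` peaks midway between
  -- `p` and `q`, and `s` is at least as close to the peak as `t`. In general the difference factors
  -- into two nonnegative terms.
  [p-t][t-q]⪯[p-s][s-q] : ∀ {p q s t} → t ⪯ s → s + t ⪯ p + q →
                          (p - t) * (t - q) ⪯ (p - s) * (s - q)
  [p-t][t-q]⪯[p-s][s-q] {p} {q} {s} {t} t⪯s s+t⪯p+q = 0⪯≈-⇒⪯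
    (solve 4 (λ p q s t →
        (p :- s) :* (s :- q) :- (p :- t) :* (t :- q) := (s :- t) :* ((p :+ q) :- (s :+ t)))
      refl p q s t)
    (0⪯* (⪯⇒0⪯- t⪯s) (⪯⇒0⪯- s+t⪯p+q))

  -- Powers, signs and decreasing sequences.

  1^n≈1 : ∀ n → 1# ^ n ≈ 1#
  1^n≈1 zero    = refl
  1^n≈1 (suc n) = trans (*-identityˡ _) (1^n≈1 n)

  product-^ : ∀ {m} (f : Vector Carrier m) n → product (λ j → f j ^ n) ≈ product f ^ n
  product-^ {zero}  f n = sym (1^n≈1 n)
  product-^ {suc m} f n = trans (*-congˡ (product-^ (tail f) n)) (sym (^-distrib-* _ _ n))

  -- The sign alternates with `n`. Leaving it undetermined is enough, since each `â` bounds both `a`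
  -- and `- a`.
  neg-^ : ∀ x n → (- x) ^ n ≈ x ^ n ⊎ (- x) ^ n ≈ - (x ^ n)
  neg-^ x zero    = inj₁ refl
  neg-^ x (suc n) with neg-^ x n
  ... | inj₁ eq = inj₂ (trans (*-congˡ eq)
    (solve 2 (λ x y → (:- x) :* y := :- (x :* y)) refl x (x ^ n)))
  ... | inj₂ eq = inj₁ (trans (*-congˡ eq)
    (solve 2 (λ x y → (:- x) :* (:- y) := x :* y) refl x (x ^ n)))

  antitone : ∀ {n} (x : Vector Carrier (suc n)) → (∀ i → x (suc i) ⪯ x (inject₁ i)) →
             ∀ {i j} → i ≤ j → x j ⪯ x i
  antitone         x step {zero}  {zero}  i≤j = ⪯-refl
  antitone {suc n} x step {zero}  {suc j} i≤j =
    ⪯-trans (antitone (tail x) (λ i → step (suc i)) {zero} {j} z≤n) (step zero)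
  antitone {suc n} x step {suc i} {suc j} i≤j =
    antitone (tail x) (λ i → step (suc i)) (s≤s⁻¹ i≤j)

  -- Replaces an even-indexed term by its worst case, whichever sign the power of the product takes.
  -*⪯* : ∀ {a â p t} → UpperBound ⟦± a ⟧ â → 0# ⪯ p → t ≈ p ⊎ t ≈ - p → - (â * p) ⪯ a * t
  -*⪯* {a} {â} {p} {t} ub 0⪯p (inj₁ t≈p) = 0⪯≈-⇒⪯
    (trans (+-congʳ (*-congˡ t≈p))
      (solve 3 (λ a â p → a :* p :- (:- (â :* p)) := (â :- (:- a)) :* p) refl a â p))
    (0⪯* (⪯⇒0⪯- (ub (- a) (inj₂ refl))) 0⪯p)
  -*⪯* {a} {â} {p} {t} ub 0⪯p (inj₂ t≈-p) = 0⪯≈-⇒⪯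
    (trans (+-congʳ (*-congˡ t≈-p))
      (solve 3 (λ a â p → a :* (:- p) :- (:- (â :* p)) := (â :- a) :* p) refl a â p))
    (0⪯* (⪯⇒0⪯- (ub a (inj₁ refl))) 0⪯p)

  -- Majorization and its closure under products.

  -- The pair {a , d} weakly majorizes {b , c}, and moreover d ⪯ b ⪯ a; this extra
  -- ordering is what makes the relation stable under products.
  record Majorizes (a b c d : Carrier) : Set ℓ₂ where
    field
      0⪯c     : 0# ⪯ c
      0⪯d     : 0# ⪯ d
      d⪯b     : d ⪯ b
      b⪯a     : b ⪯ a
      b+c⪯a+d : b + c ⪯ a + d

    0⪯b : 0# ⪯ b
    0⪯b = ⪯-trans 0⪯d d⪯b

    0⪯a : 0# ⪯ a
    0⪯a = ⪯-trans 0⪯b b⪯a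

    c⪯a : c ⪯ a
    c⪯a = 0⪯≈-⇒⪯
      (solve 4 (λ a b c d → a :- c := ((a :+ d) :- (b :+ c)) :+ (b :- d)) refl a b c d)
      (0⪯+ (⪯⇒0⪯- b+c⪯a+d) (⪯⇒0⪯- d⪯b))

  open Majorizes

  majorizes-* : ∀ {a b c d a′ b′ c′ d′} → Majorizes a b c d → Majorizes a′ b′ c′ d′ →
                Majorizes (a * a′) (b * b′) (c * c′) (d * d′)
  majorizes-* {a} {b} {c} {d} {a′} {b′} {c′} {d′} m m′ = record
    { 0⪯c     = 0⪯* (0⪯c m) (0⪯c m′)
    ; 0⪯d     = 0⪯* (0⪯d m) (0⪯d m′)
    ; d⪯b     = *-mono-⪯ (0⪯d m) (d⪯b m) (0⪯d m′) (d⪯b m′)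
    ; b⪯a     = *-mono-⪯ (0⪯b m) (b⪯a m) (0⪯b m′) (b⪯a m′)
    -- A summation by parts: two terms weight the majorization gaps of `m′` and `m` by `c` and `d′`,
    -- the other two multiply order gaps. The extra ordering `d ⪯ b` enters through `c⪯a` and
    -- `b′ - d′`.
    ; b+c⪯a+d = 0⪯≈-⇒⪯
        (solve 8 (λ a b c d a′ b′ c′ d′ →
            (a :* a′ :+ d :* d′) :- (b :* b′ :+ c :* c′) :=
            ((a :- c) :* (a′ :- b′) :+ c :* ((a′ :+ d′) :- (b′ :+ c′))) :+
            ((a :- b) :* (b′ :- d′) :+ ((a :+ d) :- (b :+ c)) :* d′))
          refl a b c d a′ b′ c′ d′)
        (0⪯+ (0⪯+ (0⪯* (⪯⇒0⪯- (c⪯a m)) (⪯⇒0⪯- (b⪯a m′))) (0⪯* (0⪯c m) (⪯⇒0⪯- (b+c⪯a+d m′))))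
             (0⪯+ (0⪯* (⪯⇒0⪯- (b⪯a m)) (⪯⇒0⪯- (d⪯b m′))) (0⪯* (⪯⇒0⪯- (b+c⪯a+d m)) (0⪯d m′))))
    }

  -- Meant for the mutual differences of `x ₁`, `x ₂`, `x ₅`, `x ₆`. Since `s` dominates `m`, the
  -- order `d⪯b` is obtained only after weighting them by `v` and `u`, so the three factors are kept
  -- together.
  majorizes-triple : ∀ {u v s l t m} →
    0# ⪯ v → v ⪯ u → 0# ⪯ t → t ⪯ m → m ⪯ s → m ⪯ l → s * v ⪯ u * m →
    Majorizes (u * (s * l)) (u * (t * m)) (v * (l * m)) (v * (s * t))
  majorizes-triple {u} {v} {s} {l} {t} {m} 0⪯v v⪯u 0⪯t t⪯m m⪯s m⪯l sv⪯um = record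
    { 0⪯c     = 0⪯* 0⪯v (0⪯* 0⪯l 0⪯m)
    ; 0⪯d     = 0⪯* 0⪯v (0⪯* 0⪯s 0⪯t)
    ; d⪯b     = 0⪯≈-⇒⪯
        (solve 5 (λ u v s t m →
            u :* (t :* m) :- v :* (s :* t) := t :* (u :* m :- s :* v))
          refl u v s t m)
        (0⪯* 0⪯t (⪯⇒0⪯- sv⪯um))
    ; b⪯a     = *-mono-⪯ 0⪯u ⪯-refl (0⪯* 0⪯t 0⪯m) tm⪯sl
    ; b+c⪯a+d = 0⪯≈-⇒⪯
        (solve 6 (λ u v s l t m →
            (u :* (s :* l) :+ v :* (s :* t)) :- (u :* (t :* m) :+ v :* (l :* m)) :=
            (u :- v) :* (s :* l :- t :* m) :+ v :* ((s :- m) :* (l :+ t)))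
          refl u v s l t m)
        (0⪯+ (0⪯* (⪯⇒0⪯- v⪯u) (⪯⇒0⪯- tm⪯sl)) (0⪯* 0⪯v (0⪯* (⪯⇒0⪯- m⪯s) (0⪯+ 0⪯l 0⪯t))))
    }
    where
    0⪯u = ⪯-trans 0⪯v v⪯u
    0⪯m = ⪯-trans 0⪯t t⪯m
    0⪯s = ⪯-trans 0⪯m m⪯s
    0⪯l = ⪯-trans 0⪯m m⪯l
    tm⪯sl : t * m ⪯ s * l
    tm⪯sl = *-mono-⪯ 0⪯t (⪯-trans t⪯m m⪯s) 0⪯m m⪯l

  -- Nonnegativity of the weighted alternating sum.

  weighted-sum : ∀ {a₁ b₂ a₃ b₄ a₅ b₆ a₇ p₁ p₂ p₃ p₄ p₅ p₆ p₇} →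
    Majorizes p₁ p₂ p₆ p₅ → 0# ⪯ p₄ → p₄ ⪯ p₃ → p₆ ⪯ p₇ →
    b₂ ⪯ a₁ → a₅ ⪯ b₂ → b₆ ⪯ a₅ → 0# ⪯ b₆ → b₄ ⪯ a₃ → 0# ⪯ b₄ →
    (b₆ ⪯ a₅ + a₇ × a₇ ⪯ b₆ × 0# ⪯ a₇) ⊎ (b₆ ⪯ a₇ × 0# ⪯ b₆) →
    0# ⪯ a₁ * p₁ + (- (b₂ * p₂) + (a₃ * p₃ + (- (b₄ * p₄) +
           (a₅ * p₅ + (- (b₆ * p₆) + a₇ * p₇)))))
  weighted-sum {a₁} {b₂} {a₃} {b₄} {a₅} {b₆} {a₇} {p₁} {p₂} {p₃} {p₄} {p₅} {p₆} {p₇}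
    maj 0⪯p₄ p₄⪯p₃ p₆⪯p₇ b₂⪯a₁ a₅⪯b₂ b₆⪯a₅ 0⪯b₆ b₄⪯a₃ 0⪯b₄ = λ where
      -- The weight `b₆` is covered jointly: `a₅` goes to the four-term gap of the majorization and
      -- `a₇` to `p₇ - p₆`, which leaves `p₆` the nonnegative weight `(a₅ + a₇) - b₆`.
      (inj₁ (b₆⪯a₅+a₇ , _ , 0⪯a₇)) → 0⪯-resp-≈
        (solve 14 (λ a₁ b₂ a₃ b₄ a₅ b₆ a₇ p₁ p₂ p₃ p₄ p₅ p₆ p₇ →
            a₁ :* p₁ :+ (:- (b₂ :* p₂) :+ (a₃ :* p₃ :+ (:- (b₄ :* p₄) :+
              (a₅ :* p₅ :+ (:- (b₆ :* p₆) :+ a₇ :* p₇))))) :=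
            ((a₁ :- b₂) :* p₁ :+ ((a₃ :- b₄) :* p₃ :+ b₄ :* (p₃ :- p₄))) :+
            (((b₂ :- a₅) :* (p₁ :- p₂) :+ a₅ :* ((p₁ :+ p₅) :- (p₂ :+ p₆))) :+
             (((a₅ :+ a₇) :- b₆) :* p₆ :+ a₇ :* (p₇ :- p₆))))
          refl a₁ b₂ a₃ b₄ a₅ b₆ a₇ p₁ p₂ p₃ p₄ p₅ p₆ p₇)
        (0⪯+ 0⪯terms-1-3-4
          (0⪯+ (0⪯+ (0⪯* (⪯⇒0⪯- a₅⪯b₂) 0⪯p₁-p₂) (0⪯* 0⪯a₅ (⪯⇒0⪯- (b+c⪯a+d maj))))
               (0⪯+ (0⪯* (⪯⇒0⪯- b₆⪯a₅+a₇) (0⪯c maj)) (0⪯* 0⪯a₇ (⪯⇒0⪯- p₆⪯p₇)))))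
      -- Here `a₇` alone covers `b₆`, so `a₅ * p₅` stands by itself and the sum splits into
      -- consecutive pairs.
      (inj₂ (b₆⪯a₇ , _)) → 0⪯-resp-≈
        (solve 14 (λ a₁ b₂ a₃ b₄ a₅ b₆ a₇ p₁ p₂ p₃ p₄ p₅ p₆ p₇ →
            a₁ :* p₁ :+ (:- (b₂ :* p₂) :+ (a₃ :* p₃ :+ (:- (b₄ :* p₄) :+
              (a₅ :* p₅ :+ (:- (b₆ :* p₆) :+ a₇ :* p₇))))) :=
            ((a₁ :- b₂) :* p₁ :+ ((a₃ :- b₄) :* p₃ :+ b₄ :* (p₃ :- p₄))) :+
            ((b₂ :* (p₁ :- p₂) :+ a₅ :* p₅) :+ ((a₇ :- b₆) :* p₇ :+ b₆ :* (p₇ :- p₆))))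
          refl a₁ b₂ a₃ b₄ a₅ b₆ a₇ p₁ p₂ p₃ p₄ p₅ p₆ p₇)
        (0⪯+ 0⪯terms-1-3-4
          (0⪯+ (0⪯+ (0⪯* (⪯-trans 0⪯a₅ a₅⪯b₂) 0⪯p₁-p₂) (0⪯* 0⪯a₅ (0⪯d maj)))
               (0⪯+ (0⪯* (⪯⇒0⪯- b₆⪯a₇) (⪯-trans (0⪯c maj) p₆⪯p₇)) (0⪯* 0⪯b₆ (⪯⇒0⪯- p₆⪯p₇)))))
    where
    0⪯a₅ = ⪯-trans 0⪯b₆ b₆⪯a₅
    0⪯p₁-p₂ = ⪯⇒0⪯- (b⪯a maj)
    0⪯terms-1-3-4 =
      0⪯+ (0⪯* (⪯⇒0⪯- b₂⪯a₁) (0⪯a maj))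
          (0⪯+ (0⪯* (⪯⇒0⪯- b₄⪯a₃) (⪯-trans 0⪯p₄ p₄⪯p₃)) (0⪯* 0⪯b₄ (⪯⇒0⪯- p₄⪯p₃)))

  -- Powers once the unit is nonnegative.

  module _ (0⪯1 : 0# ⪯ 1#) where

    0⪯^ : ∀ {x} n → 0# ⪯ x → 0# ⪯ x ^ n
    0⪯^ zero    0⪯x = 0⪯1
    0⪯^ (suc n) 0⪯x = 0⪯* 0⪯x (0⪯^ n 0⪯x)

    ^-mono-⪯ : ∀ {x y} n → 0# ⪯ x → x ⪯ y → x ^ n ⪯ y ^ n
    ^-mono-⪯ zero    0⪯x x⪯y = ⪯-refl
    ^-mono-⪯ (suc n) 0⪯x x⪯y = *-mono-⪯ 0⪯x x⪯y (0⪯^ n 0⪯x) (^-mono-⪯ n 0⪯x x⪯y)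

    majorizes-^ : ∀ {a b c d} n → Majorizes a b c d → Majorizes (a ^ n) (b ^ n) (c ^ n) (d ^ n)
    majorizes-^ zero    maj = record
      { 0⪯c = 0⪯1 ; 0⪯d = 0⪯1 ; d⪯b = ⪯-refl ; b⪯a = ⪯-refl ; b+c⪯a+d = ⪯-refl }
    majorizes-^ (suc n) maj = majorizes-* maj (majorizes-^ n maj)

  -- Differences of the seven points and their products.

  module SevenPoints
    (x : Vector Carrier 7) (step : (i : Fin 6) → x (suc i) ⪯ x (inject₁ i))
    (x₂+x₅⪯x₁+x₆ : x ₂ + x ₅ ⪯ x ₁ + x ₆) (x₃+x₄⪯x₂+x₅ : x ₃ + x ₄ ⪯ x ₂ + x ₅)
    where

    Δ : Fin 7 → Fin 7 → Carrier
    Δ i j = x i - x j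

    x⪯ : ∀ i j {i≤j : True (i ≤? j)} → x j ⪯ x i
    x⪯ i j {i≤j} = antitone x step (toWitness i≤j)

    0⪯Δ : ∀ i j {i≤j : True (i ≤? j)} → 0# ⪯ Δ i j
    0⪯Δ i j {i≤j} = ⪯⇒0⪯- (x⪯ i j {i≤j})

    Δ-mono : ∀ {p q r s} → x p + x s ⪯ x r + x q → Δ p q ⪯ Δ r s
    Δ-mono {p} {q} {r} {s} xp+xs⪯xr+xq = 0⪯≈-⇒⪯
      (solve 4 (λ p q r s → (r :- s) :- (p :- q) := (r :+ q) :- (p :+ s))
        refl (x p) (x q) (x r) (x s))
      (⪯⇒0⪯- xp+xs⪯xr+xq)

    Δ-nested : ∀ p q r s {r≤p : True (r ≤? p)} {q≤s : True (q ≤? s)} → Δ p q ⪯ Δ r s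
    Δ-nested p q r s {r≤p} {q≤s} = Δ-mono (+-mono-⪯ (x⪯ r p {r≤p}) (x⪯ q s {q≤s}))

    x₃+x₄⪯x₁+x₆ : x ₃ + x ₄ ⪯ x ₁ + x ₆
    x₃+x₄⪯x₁+x₆ = ⪯-trans x₃+x₄⪯x₂+x₅ x₂+x₅⪯x₁+x₆

    -- Both sides of the sum condition contain `x k - x j`; cancelling it leaves
    -- `x ₂ + x ₅ ⪯ x ₁ + x ₆`.
    majorizes-Δ : ∀ j k → 0# ⪯ Δ k ₆ → 0# ⪯ Δ k ₅ → x k + x j ⪯ x ₂ + x ₅ →
                  Majorizes (Δ ₁ j) (Δ ₂ j) (Δ k ₆) (Δ k ₅)
    majorizes-Δ j k 0⪯Δk₆ 0⪯Δk₅ xk+xj⪯x₂+x₅ = record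
      { 0⪯c     = 0⪯Δk₆
      ; 0⪯d     = 0⪯Δk₅
      ; d⪯b     = Δ-mono xk+xj⪯x₂+x₅
      ; b⪯a     = +-mono-⪯ (x⪯ ₁ ₂) ⪯-refl
      ; b+c⪯a+d = 0⪯≈-⇒⪯
          (solve 6 (λ x₁ x₂ x₅ x₆ j k →
              ((x₁ :- j) :+ (k :- x₅)) :- ((x₂ :- j) :+ (k :- x₆)) := (x₁ :+ x₆) :- (x₂ :+ x₅))
            refl (x ₁) (x ₂) (x ₅) (x ₆) (x j) (x k))
          (⪯⇒0⪯- x₂+x₅⪯x₁+x₆)
      }

    -- As `x ₇` lies below all the other points, the sum condition holds term by term.
    majorizes-Δ₇ : Majorizes (Δ ₁ ₇) (Δ ₂ ₇) (Δ ₆ ₇) (Δ ₅ ₇)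
    majorizes-Δ₇ = record
      { 0⪯c     = 0⪯Δ ₆ ₇
      ; 0⪯d     = 0⪯Δ ₅ ₇
      ; d⪯b     = Δ-nested ₅ ₇ ₂ ₇
      ; b⪯a     = Δ-nested ₂ ₇ ₁ ₇
      ; b+c⪯a+d = +-mono-⪯ (Δ-nested ₂ ₇ ₁ ₇) (Δ-nested ₆ ₇ ₅ ₇)
      }

    -- The grouping follows the comparisons below. `Q₁`, `Q₂`, `Q₅`, `Q₆` start with the block of
    -- `x ₁`, `x ₂`, `x ₅`, `x ₆`; `Q₃` and `Q₄` pair the distances to `x ₁`, `x ₆` and to `x ₂`,
    -- `x ₅`; `Q₇` copies the shape of `Q₆`.
    Q₁ Q₂ Q₃ Q₄ Q₅ Q₆ Q₇ : Carrier
    Q₁ = (Δ ₁ ₂ * (Δ ₁ ₅ * Δ ₁ ₆)) * (Δ ₁ ₃ * (Δ ₁ ₄ * Δ ₁ ₇))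
    Q₂ = (Δ ₁ ₂ * (Δ ₂ ₅ * Δ ₂ ₆)) * (Δ ₂ ₃ * (Δ ₂ ₄ * Δ ₂ ₇))
    Q₃ = ((Δ ₁ ₃ * Δ ₃ ₆) * (Δ ₂ ₃ * Δ ₃ ₅)) * (Δ ₃ ₄ * Δ ₃ ₇)
    Q₄ = ((Δ ₁ ₄ * Δ ₄ ₆) * (Δ ₂ ₄ * Δ ₄ ₅)) * (Δ ₃ ₄ * Δ ₄ ₇)
    Q₅ = (Δ ₅ ₆ * (Δ ₁ ₅ * Δ ₂ ₅)) * (Δ ₄ ₅ * (Δ ₃ ₅ * Δ ₅ ₇))
    Q₆ = (Δ ₅ ₆ * (Δ ₁ ₆ * Δ ₂ ₆)) * (Δ ₄ ₆ * (Δ ₃ ₆ * Δ ₆ ₇))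
    Q₇ = (Δ ₅ ₇ * (Δ ₁ ₇ * Δ ₂ ₇)) * (Δ ₄ ₇ * (Δ ₃ ₇ * Δ ₆ ₇))

    -- The points x₃ and x₄ are interchanged between the factors Δ ₁ _ , Δ ₂ _ and Δ _ ₆ , Δ _ ₅,
    -- because x₂ + x₅ ⪰ x₃ + x₄ compares Δ ₂ ₃ with Δ ₄ ₅ and Δ ₂ ₄ with Δ ₃ ₅.
    majorizes-Q : Majorizes Q₁ Q₂ Q₆ Q₅
    majorizes-Q = majorizes-*
      (majorizes-triple
        (0⪯Δ ₅ ₆) (Δ-mono (≤-respˡ-≈ (+-comm (x ₂) (x ₅)) x₂+x₅⪯x₁+x₆))
        (0⪯Δ ₂ ₅) (Δ-nested ₂ ₅ ₂ ₆) (Δ-mono x₂+x₅⪯x₁+x₆) (Δ-nested ₂ ₆ ₁ ₆)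
        ([p-t][t-q]⪯[p-s][s-q] (x⪯ ₂ ₅) x₂+x₅⪯x₁+x₆))
      (majorizes-*
        (majorizes-Δ ₃ ₄ (0⪯Δ ₄ ₆) (0⪯Δ ₄ ₅) (≤-respˡ-≈ (+-comm (x ₃) (x ₄)) x₃+x₄⪯x₂+x₅))
        (majorizes-* (majorizes-Δ ₄ ₃ (0⪯Δ ₃ ₆) (0⪯Δ ₃ ₅) x₃+x₄⪯x₂+x₅) majorizes-Δ₇))

    0⪯Q₄ : 0# ⪯ Q₄
    0⪯Q₄ = 0⪯* (0⪯* (0⪯* (0⪯Δ ₁ ₄) (0⪯Δ ₄ ₆)) (0⪯* (0⪯Δ ₂ ₄) (0⪯Δ ₄ ₅)))
               (0⪯* (0⪯Δ ₃ ₄) (0⪯Δ ₄ ₇))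

    -- The quadratics with roots `x ₁`, `x ₆` and `x ₂`, `x ₅` are at least as large at `x ₃` as at
    -- `x ₄`. The factor `Δ ₃ ₄` is common, and `x ₃` is farther from `x ₇`.
    Q₄⪯Q₃ : Q₄ ⪯ Q₃
    Q₄⪯Q₃ = *-mono-⪯
      (0⪯* (0⪯* (0⪯Δ ₁ ₄) (0⪯Δ ₄ ₆)) (0⪯* (0⪯Δ ₂ ₄) (0⪯Δ ₄ ₅)))
      (*-mono-⪯ (0⪯* (0⪯Δ ₁ ₄) (0⪯Δ ₄ ₆)) ([p-t][t-q]⪯[p-s][s-q] (x⪯ ₃ ₄) x₃+x₄⪯x₁+x₆)
                (0⪯* (0⪯Δ ₂ ₄) (0⪯Δ ₄ ₅)) ([p-t][t-q]⪯[p-s][s-q] (x⪯ ₃ ₄) x₃+x₄⪯x₂+x₅))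
      (0⪯* (0⪯Δ ₃ ₄) (0⪯Δ ₄ ₇))
      (*-mono-⪯ (0⪯Δ ₃ ₄) ⪯-refl (0⪯Δ ₄ ₇) (Δ-nested ₄ ₇ ₃ ₇))

    -- Each of the first five points is at least as far from `x ₇` as from `x ₆`, and `Δ ₆ ₇` is
    -- common.
    Q₆⪯Q₇ : Q₆ ⪯ Q₇
    Q₆⪯Q₇ = *-mono-⪯
      (0⪯* (0⪯Δ ₅ ₆) (0⪯* (0⪯Δ ₁ ₆) (0⪯Δ ₂ ₆)))
      (*-mono-⪯ (0⪯Δ ₅ ₆) (Δ-nested ₅ ₆ ₅ ₇) (0⪯* (0⪯Δ ₁ ₆) (0⪯Δ ₂ ₆))
        (*-mono-⪯ (0⪯Δ ₁ ₆) (Δ-nested ₁ ₆ ₁ ₇) (0⪯Δ ₂ ₆) (Δ-nested ₂ ₆ ₂ ₇)))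
      (0⪯* (0⪯Δ ₄ ₆) (0⪯* (0⪯Δ ₃ ₆) (0⪯Δ ₆ ₇)))
      (*-mono-⪯ (0⪯Δ ₄ ₆) (Δ-nested ₄ ₆ ₄ ₇) (0⪯* (0⪯Δ ₃ ₆) (0⪯Δ ₆ ₇))
        (*-mono-⪯ (0⪯Δ ₃ ₆) (Δ-nested ₃ ₆ ₃ ₇) (0⪯Δ ₆ ₇) ⪯-refl))

    -- Signs of the products.

    others : Fin 7 → Vector Carrier 6
    others i = removeAt (Δ i) i

    ∏-others : ∀ i {a b c d e g} → let f = others i in
      f ₁ ≈ a → f ₂ ≈ b → f ₃ ≈ c → f ₄ ≈ d → f ₅ ≈ e → f ₆ ≈ g →
      product f ≈ a * (b * (c * (d * (e * g))))
    ∏-others i a b c d e g =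
      *-cong a (*-cong b (*-cong c (*-cong d (*-cong e (trans (*-identityʳ _) g)))))

    flip : ∀ i j → Δ i j ≈ - Δ j i
    flip i j = sym (⁻¹-anti-homo‿- (x j) (x i))

    -- In this and the next six lemmas, one factor is flipped for each point preceding the chosen
    -- one, so the signs alternate.
    product₁ : product (others ₁) ≈ Q₁
    product₁ = trans (∏-others ₁ refl refl refl refl refl refl)
      (solve 6 (λ d₂ d₃ d₄ d₅ d₆ d₇ →
          d₂ :* (d₃ :* (d₄ :* (d₅ :* (d₆ :* d₇)))) := (d₂ :* (d₅ :* d₆)) :* (d₃ :* (d₄ :* d₇)))
        refl (Δ ₁ ₂) (Δ ₁ ₃) (Δ ₁ ₄) (Δ ₁ ₅) (Δ ₁ ₆) (Δ ₁ ₇))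

    product₂ : product (others ₂) ≈ - Q₂
    product₂ = trans (∏-others ₂ (flip ₂ ₁) refl refl refl refl refl)
      (solve 6 (λ d₁ d₃ d₄ d₅ d₆ d₇ →
          (:- d₁) :* (d₃ :* (d₄ :* (d₅ :* (d₆ :* d₇)))) :=
          :- ((d₁ :* (d₅ :* d₆)) :* (d₃ :* (d₄ :* d₇))))
        refl (Δ ₁ ₂) (Δ ₂ ₃) (Δ ₂ ₄) (Δ ₂ ₅) (Δ ₂ ₆) (Δ ₂ ₇))

    product₃ : product (others ₃) ≈ Q₃
    product₃ = trans (∏-others ₃ (flip ₃ ₁) (flip ₃ ₂) refl refl refl refl)
      (solve 6 (λ d₁ d₂ d₄ d₅ d₆ d₇ →
          (:- d₁) :* ((:- d₂) :* (d₄ :* (d₅ :* (d₆ :* d₇)))) :=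
          ((d₁ :* d₆) :* (d₂ :* d₅)) :* (d₄ :* d₇))
        refl (Δ ₁ ₃) (Δ ₂ ₃) (Δ ₃ ₄) (Δ ₃ ₅) (Δ ₃ ₆) (Δ ₃ ₇))

    product₄ : product (others ₄) ≈ - Q₄
    product₄ = trans (∏-others ₄ (flip ₄ ₁) (flip ₄ ₂) (flip ₄ ₃) refl refl refl)
      (solve 6 (λ d₁ d₂ d₃ d₅ d₆ d₇ →
          (:- d₁) :* ((:- d₂) :* ((:- d₃) :* (d₅ :* (d₆ :* d₇)))) :=
          :- (((d₁ :* d₆) :* (d₂ :* d₅)) :* (d₃ :* d₇)))
        refl (Δ ₁ ₄) (Δ ₂ ₄) (Δ ₃ ₄) (Δ ₄ ₅) (Δ ₄ ₆) (Δ ₄ ₇))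

    product₅ : product (others ₅) ≈ Q₅
    product₅ = trans (∏-others ₅ (flip ₅ ₁) (flip ₅ ₂) (flip ₅ ₃) (flip ₅ ₄) refl refl)
      (solve 6 (λ d₁ d₂ d₃ d₄ d₆ d₇ →
          (:- d₁) :* ((:- d₂) :* ((:- d₃) :* ((:- d₄) :* (d₆ :* d₇)))) :=
          (d₆ :* (d₁ :* d₂)) :* (d₄ :* (d₃ :* d₇)))
        refl (Δ ₁ ₅) (Δ ₂ ₅) (Δ ₃ ₅) (Δ ₄ ₅) (Δ ₅ ₆) (Δ ₅ ₇))

    product₆ : product (others ₆) ≈ - Q₆
    product₆ = trans (∏-others ₆ (flip ₆ ₁) (flip ₆ ₂) (flip ₆ ₃) (flip ₆ ₄) (flip ₆ ₅) refl)
      (solve 6 (λ d₁ d₂ d₃ d₄ d₅ d₇ →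
          (:- d₁) :* ((:- d₂) :* ((:- d₃) :* ((:- d₄) :* ((:- d₅) :* d₇)))) :=
          :- ((d₅ :* (d₁ :* d₂)) :* (d₄ :* (d₃ :* d₇))))
        refl (Δ ₁ ₆) (Δ ₂ ₆) (Δ ₃ ₆) (Δ ₄ ₆) (Δ ₅ ₆) (Δ ₆ ₇))

    product₇ : product (others ₇) ≈ Q₇
    product₇ = trans (∏-others ₇ (flip ₇ ₁) (flip ₇ ₂) (flip ₇ ₃) (flip ₇ ₄) (flip ₇ ₅) (flip ₇ ₆))
      (solve 6 (λ d₁ d₂ d₃ d₄ d₅ d₆ →
          (:- d₁) :* ((:- d₂) :* ((:- d₃) :* ((:- d₄) :* ((:- d₅) :* (:- d₆))))) :=
          (d₅ :* (d₁ :* d₂)) :* (d₄ :* (d₃ :* d₆)))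
        refl (Δ ₁ ₇) (Δ ₂ ₇) (Δ ₃ ₇) (Δ ₄ ₇) (Δ ₅ ₇) (Δ ₆ ₇))

    -- The power sits inside `removeAt` as in the goal. By computation this is the product of the
    -- powers of `others i`, to which `product-^` applies.
    powers : Fin 7 → ℕ → Carrier
    powers i n = product (removeAt (λ j → Δ i j ^ n) i)

    powers-odd : ∀ {i q} n → product (others i) ≈ q → powers i n ≈ q ^ n
    powers-odd {i} n eq = trans (product-^ (others i) n) (^-congˡ n eq)

    powers-even : ∀ {i q} n → product (others i) ≈ - q →
                  powers i n ≈ q ^ n ⊎ powers i n ≈ - (q ^ n)
    powers-even {q = q} n eq =
      Sum.map (trans (powers-odd n eq)) (trans (powers-odd n eq)) (neg-^ q n)

theorem14 : {c ℓ₁ ℓ₂ : Level} (I : PartiallyOrderedCommutativeRing c ℓ₁ ℓ₂) →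
    let open PartiallyOrderedCommutativeRing I in
    (x : Vector Carrier 7) →
    ((i : Fin 6) → x (inject₁ i) ⪰ x (suc i)) →
    x ₁ + x ₆ ⪰ x ₂ + x ₅ →
    x ₂ + x ₅ ⪰ x ₃ + x ₄ →
    (n : ℕ) →
    (inverse : Invertible _≈_ 1# _*_ (x ₂ - x ₆)) →
    proj₁ inverse ≻ 0# →
    (a : Vector Carrier 7) →
    (â₂ â₄ â₆ : Carrier) →
    UpperBound ⟦± a ₂ ⟧ â₂ →
    UpperBound ⟦± a ₄ ⟧ â₄ →
    UpperBound ⟦± a ₆ ⟧ â₆ →
    a ₁ ⪰ â₂ → â₂ ⪰ a ₅ → a ₅ ⪰ â₆ → â₆ ⪰ 0# →
    a ₃ ⪰ â₄ → â₄ ⪰ 0# →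
    (a ₅ + a ₇ ⪰ â₆ × â₆ ⪰ a ₇ × a ₇ ⪰ 0#) ⊎ (a ₇ ⪰ â₆ × â₆ ⪰ 0#) →
    sum (λ i → a i * product (removeAt (λ j → (x i - x j) ^ n) i)) ⪰ 0#
theorem14 I x step x₁+x₆⪰x₂+x₅ x₂+x₅⪰x₃+x₄ n (_ , y*Δ≈1 , _) (y⪰0 , _)
  a _ _ _ ub₂ ub₄ ub₆ a₁⪰â₂ â₂⪰a₅ a₅⪰â₆ â₆⪰0 a₃⪰â₄ â₄⪰0 a₇-large =
  ⪯-trans
    (weighted-sum maj
      (0⪯^ 0⪯1 n 0⪯Q₄) (^-mono-⪯ 0⪯1 n 0⪯Q₄ Q₄⪯Q₃) (^-mono-⪯ 0⪯1 n (0⪯c majorizes-Q) Q₆⪯Q₇)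
      a₁⪰â₂ â₂⪰a₅ a₅⪰â₆ â₆⪰0 a₃⪰â₄ â₄⪰0 a₇-large)
    (+-mono-⪯ (odd {₁} product₁) (+-mono-⪯ (-*⪯* ub₂ (0⪯b maj) (powers-even n product₂))
    (+-mono-⪯ (odd {₃} product₃) (+-mono-⪯ (-*⪯* ub₄ (0⪯^ 0⪯1 n 0⪯Q₄) (powers-even n product₄))
    (+-mono-⪯ (odd {₅} product₅) (+-mono-⪯ (-*⪯* ub₆ (0⪯c maj) (powers-even n product₆))
    -- `sum` ends in `0#`, which is absorbed into the seventh term.
    (≤-respʳ-≈ (sym (+-identityʳ _)) (odd {₇} product₇))))))))
  where
  open PartiallyOrderedCommutativeRing I
  open OrderedRing I
  open IsPartialOrder isPartialOrder using (≤-respʳ-≈)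
    renaming (reflexive to ⪯-reflexive; trans to ⪯-trans)
  open Majorizes
  open SevenPoints x step x₁+x₆⪰x₂+x₅ x₂+x₅⪰x₃+x₄

  0⪯1 : 0# ⪯ 1#
  0⪯1 = 0⪯-resp-≈ (sym y*Δ≈1) (0⪯* y⪰0 (0⪯Δ ₂ ₆))

  maj = majorizes-^ 0⪯1 n majorizes-Q

  odd : ∀ {i q} → product (others i) ≈ q → a i * q ^ n ⪯ a i * powers i n
  odd eq = ⪯-reflexive (*-congˡ (sym (powers-odd n eq)))
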